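{- Let $m,n\ge 2$ and $k\ge1$, and let $\mathcal{F}_1,\dots,\mathcal{F}_k$ be pairwise almost orthogonal symmetric chain decompositions of $Q_m$ and $\mathcal{G}_1,\dots,\mathcal{G}_k$ pairwise almost orthogonal symmetric chain decompositions of $Q_n$. Then there exist $k$ pairwise almost orthogonal symmetric chain decompositions $\mathcal{H}_1,\dots,\mathcal{H}_k$ of $Q_m\times Q_n=Q_{m+n}$ such that for each $i$ every chain of $\mathcal{H}_i$ is contained in a rectangle $A\times C$ with $A\in\mathcal{F}_i$, $C\in\mathcal{G}_i$ (i.e. obtained by decomposing the rectangles of $\mathcal{F}_i\times\mathcal{G}_i$ into symmetric chains), if and only if both collections $\{\mathcal{F}_i\}$ and $\{\mathcal{G}_i\}$ are good.
   Context: $Q_n$ denotes the Boolean lattice of subsets of $[n]=\{1,\dots,n\}$ under inclusion; $Q_m\times Q_n$ (product order) is identified with $Q_{m+n}$. A symmetric chain in $Q_n$ consists of exactly one subset of each size $j,j+1,\dots,n-j$ for some $j$; a symmetric chain decomposition (SCD) is a partition of $Q_n$ into symmetric chains. Two SCDs $\mathcal{F},\mathcal{G}$ of $Q_n$ are almost orthogonal if for all chains $A\in\mathcal{F}$, $B\in\mathcal{G}$, $|A\cap B|\le1$, except when $A$ and $B$ both contain $\varnothing$ and $[n]$, in which case $|A\cap B|=2$. A collection $\{\mathcal{F}^j\}$ of pairwise almost orthogonal SCDs of $Q_n$ is good if either $n$ is even and the $1$-element chains occurring in the different $\mathcal{F}^j$ are pairwise distinct, or $n$ is odd and the graph whose vertex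 set is the union of all $2$-element chains of all $\mathcal{F}^j$ and whose edges are these $2$-element chains admits an orientation in which every vertex has out-degree at most $1$. -}

module Defs where

open import Data.Nat using (ℕ; zero; suc; _+_; _*_; _≤_; _%_)
open import Data.Bool using (Bool)
import Data.Bool as Bool
open import Data.Fin using (Fin; toℕ)
open import Data.Fin.Subset using (Subset; _⊆_; ∣_∣; ⊥; ⊤)
open import Data.Vec using (_++_)
open import Data.Vec.Properties using (≡-dec)
open import Data.List using (List; []; _∷_; length; concat; filter; head; last; lookup)
open import Data.List.Membership.Propositional using () renaming (_∈_ to _∈ˡ_)
open import Data.List.Relation.Unary.Any using (any?)
open import Data.List.Relation.Unary.Linked using (Linked)
open import Data.List.Relation.Unary.Unique.Propositional using (Unique)
open import Data.Maybe using (just)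
open import Data.Product using (Σ; ∃; ∃-syntax; _×_; _,_)
open import Data.Sum using (_⊎_)
open import Relation.Nullary using (¬_)
open import Relation.Binary.PropositionalEquality using (_≡_; _≢_)
open import Relation.Binary.Definitions using (DecidableEquality)

_≟ˢ_ : ∀ {n} → DecidableEquality (Subset n)
_≟ˢ_ = ≡-dec Bool._≟_

-- A chain is listed as a list of subsets; we store it in increasing order.
Chain : ℕ → Set
Chain n = List (Subset n)

Cover : ∀ {n} → Subset n → Subset n → Set
Cover x y = x ⊆ y × ∣ y ∣ ≡ suc ∣ x ∣

-- A symmetric chain in Q_n: S_j ⊂ S_{j+1} ⊂ … ⊂ S_{n-j}, exactly one subset
-- of each size j, …, n-j.
IsSymChain : (n : ℕ) → Chain n → Set
IsSymChain n C =
  Linked Cover C ×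
  Σ ℕ λ j → Σ (Subset n) λ s → head C ≡ just s × ∣ s ∣ ≡ j × j + j + length C ≡ suc n

Family : ℕ → Set
Family n = List (Chain n)

IsSCD : (n : ℕ) → Family n → Set
IsSCD n F =
  (∀ C → C ∈ˡ F → IsSymChain n C) ×
  (∀ (S : Subset n) → S ∈ˡ concat F) ×
  Unique (concat F)

-- |A ∩ B| (chains have no repeated elements)
∣_∩_∣ : ∀ {n} → Chain n → Chain n → ℕ
∣ A ∩ B ∣ = length (filter (λ x → any? (x ≟ˢ_) B) A)

ContainsBoth : ∀ {n} → Chain n → Set
ContainsBoth {n} A = ⊥ ∈ˡ A × ⊤ ∈ˡ A

AlmostOrthogonal : (n : ℕ) → Family n → Family n → Set
AlmostOrthogonal n F G =
  ∀ A B → A ∈ˡ F → B ∈ˡ G →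
    ((ContainsBoth A × ContainsBoth B) → ∣ A ∩ B ∣ ≡ 2) ×
    (¬ (ContainsBoth A × ContainsBoth B) → ∣ A ∩ B ∣ ≤ 1)

PairwiseAO : (n k : ℕ) → (Fin k → Family n) → Set
PairwiseAO n k F = ∀ i j → i ≢ j → AlmostOrthogonal n (F i) (F j)

EvenCond : (n k : ℕ) → (Fin k → Family n) → Set
EvenCond n k F = ∀ i j → i ≢ j → ∀ A B → A ∈ˡ F i → B ∈ˡ F j →
  length A ≡ 1 → length B ≡ 1 → A ≢ B

-- n odd: the graph whose edges are the 2-element chains (occurrences indexed
-- by member i and position a) has an orientation with out-degree ≤ 1:
-- choose a tail vertex (inside the edge) for each edge, distinct edges
-- having distinct tails.
OddCond : (n k : ℕ) → (Fin k → Family n) → Set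
OddCond n k F =
  Σ ((i : Fin k) → Fin (length (F i)) → Subset n) λ tail →
    (∀ i a → length (lookup (F i) a) ≡ 2 → tail i a ∈ˡ lookup (F i) a) ×
    (∀ i a j b → length (lookup (F i) a) ≡ 2 → length (lookup (F j) b) ≡ 2 →
       tail i a ≡ tail j b → (i ≡ j × toℕ a ≡ toℕ b))

Good : (n k : ℕ) → (Fin k → Family n) → Set
Good n k F = (n % 2 ≡ 0 × EvenCond n k F) ⊎ (n % 2 ≡ 1 × OddCond n k F)

InRectangles : (m n : ℕ) → Family (m + n) → Family m → Family n → Set
InRectangles m n H F G =
  ∀ X → X ∈ˡ H → ∃[ A ] ∃[ C ] (A ∈ˡ F × C ∈ˡ G ×
    (∀ x → x ∈ˡ X → ∃[ S ] ∃[ T ] (S ∈ˡ A × T ∈ˡ C × x ≡ S ++ T)))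

{-# OPTIONS --safe #-}

-- The product of two chains A ∈ F i and C ∈ G i is a grid, and two chains of the
-- product decompositions can only violate almost orthogonality by sharing a full
-- row {(∅,t), ([m],t)} or a full column.  If A joins ∅ to [m] and C has one
-- element t, then a chain containing the full row at t is forced; if C = {x < y},
-- then a full row is forced at x or at y, and either choice is possible; if C has
-- at least three elements, the grid has a decomposition without full rows and
-- columns.  Thus almost orthogonality asks that the forced rows, i.e. the
-- one-element chains and the chosen ends (tails) of the two-element chains, be
-- distinct for distinct i, which is goodness.

module Submission where

open import Defs
import Algebra.Solver.CommutativeMonoid as CommutativeMonoidSolver
open import Data.Nat using (ℕ; suc; _+_; _*_; _≤_; _<_; _%_; z≤n; s≤s)
open import Data.Nat.DivMod using ([m+kn]%n≡m%n; m%n<n)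
open import Data.Nat.Properties as ℕ using (≤-refl; ≤-trans; <-irrefl; +-suc)
open import Data.Nat.Tactic.RingSolver using (solve-∀)
open import Data.Fin as Fin using (Fin; toℕ)
open import Data.Fin.Subset using (Subset; _⊆_; ∣_∣; ⊥; ⊤; inside; outside)
open import Data.Fin.Subset.Properties
  using (⊆-refl; ⊆-reflexive; ⊆-antisym; drop-∷-⊆; p⊆q⇒∣p∣≤∣q∣; ∣⊥∣≡0; ∣⊤∣≡n; ∣p∣≡n⇒p≡⊤; ∣p∣≤n)
import Data.Vec as Vec
open import Data.List
  using (List; []; _∷_; _∷ʳ_; _++_; [_]; map; head; length; concat; lookup; cartesianProductWith)
open import Data.List.Properties
  using (length-++; map-++; concat-++; ++-identityʳ; cartesianProductWith-zeroʳ; cartesianProductWith-distribʳ-++)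
open import Data.List.Membership.Propositional using () renaming (_∈_ to _∈ˡ_)
open import Data.List.Membership.Propositional.Properties
  using (∈-++⁺ˡ; ∈-++⁺ʳ; ∈-++⁻; ∈-map⁻; ∈-filter⁺; ∈-filter⁻; ∈-lookup; ∈-concat⁺′; ∈-concat⁻′;
         ∈-cartesianProductWith⁺; ∈-cartesianProductWith⁻)
open import Data.List.Relation.Unary.All as All using ([]; _∷_)
open import Data.List.Relation.Unary.AllPairs using (AllPairs; []; _∷_)
import Data.List.Relation.Unary.AllPairs.Properties as AllPairs
open import Data.List.Relation.Unary.Any as Any using (here; there; any?)
open import Data.List.Relation.Unary.Any.Properties using (lookup-index)
open import Data.List.Relation.Unary.Linked using (Linked; [-]; _∷_)
open import Data.List.Relation.Unary.Unique.Propositional using (Unique)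
import Data.List.Relation.Unary.Unique.Propositional.Properties as Unique
open import Data.List.Relation.Binary.Permutation.Propositional
  using (_↭_; ↭-refl; ↭-reflexive; ↭-sym; ↭-trans; ↭⇒↭ₛ; module PermutationReasoning)
open import Data.List.Relation.Binary.Permutation.Propositional.Properties as ↭
  using (∈-resp-↭; ++-commutativeMonoid)
open import Data.List.Relation.Binary.Permutation.Setoid.Properties using (Unique-resp-↭)
open import Data.Maybe using (just)
open import Data.Product using (Σ; ∃-syntax; _×_; _,_; proj₁; proj₂)
open import Data.Sum using (_⊎_; inj₁; inj₂)
open import Function.Base using (_∘_; case_of_; flip)
open import Function.Bundles using (_⇔_; mk⇔)
open import Relation.Nullary using (¬_; Dec; yes; no; contradiction)
open import Relation.Nullary.Decidable using (_×-dec_)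
open import Relation.Binary.PropositionalEquality
  using (_≡_; _≢_; refl; sym; trans; cong; cong₂; subst; subst₂; setoid; module ≡-Reasoning)

private variable
  m n N k : ℕ

-- Paths of covers

∣p∣≡0⇒p≡⊥ : {p : Subset n} → ∣ p ∣ ≡ 0 → p ≡ ⊥
∣p∣≡0⇒p≡⊥ {p = Vec.[]}             _  = refl
∣p∣≡0⇒p≡⊥ {p = outside Vec.∷ p} eq = cong (outside Vec.∷_) (∣p∣≡0⇒p≡⊥ eq)

⊥≢⊤ : 1 ≤ n → ⊥ {n} ≢ ⊤
⊥≢⊤ {n} 1≤n eq = ℕ.<⇒≢ 1≤n (trans (sym (∣⊥∣≡0 n)) (trans (cong ∣_∣ eq) (∣⊤∣≡n n)))

infixr 5 _∷_
-- Both ends are indices, so that joining paths and peeling them at an end is tracked by the types.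
data Path {n} : Subset n → Chain n → Subset n → Set where
  [-] : ∀ {x} → Path x (x ∷ []) x
  _∷_ : ∀ {x y z ys} → Cover x y → Path y ys z → Path x (x ∷ ys) z

-- Sizes along a path are consecutive, so the symmetry of a chain amounts to one equation between
-- its two ends.
SymPath : ∀ n → Chain n → Set
SymPath n C = ∃[ a ] ∃[ b ] (Path a C b × ∣ a ∣ + ∣ b ∣ ≡ n)

module _ {n : ℕ} where

  private variable
    a b c x y z : Subset n
    C D : Chain n

  Cover-< : Cover x y → ∣ x ∣ < ∣ y ∣
  Cover-< (_ , eq) = ℕ.≤-reflexive (sym eq)

  Path-end : Path a C b → b ∈ˡ C
  Path-end [-]     = here refl
  Path-end (_ ∷ p) = there (Path-end p)

  Path-start-⊆ : Path a C b → x ∈ˡ C → a ⊆ x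
  Path-start-⊆ [-]       (here refl) z∈ = z∈
  Path-start-⊆ (_ ∷ _)   (here refl) z∈ = z∈
  Path-start-⊆ (r ∷ p) (there x∈)  z∈ = Path-start-⊆ p x∈ (proj₁ r z∈)

  Path-start-≤ : Path a C b → x ∈ˡ C → ∣ a ∣ ≤ ∣ x ∣
  Path-start-≤ p x∈ = p⊆q⇒∣p∣≤∣q∣ (Path-start-⊆ p x∈)

  Path-end-≤ : Path a C b → x ∈ˡ C → ∣ x ∣ ≤ ∣ b ∣
  Path-end-≤ [-]     (here refl) = ≤-refl
  Path-end-≤ (r ∷ p) (here refl) = ≤-trans (ℕ.<⇒≤ (Cover-< r)) (Path-start-≤ p (Path-end p))
  Path-end-≤ (r ∷ p) (there x∈)  = Path-end-≤ p x∈

  Path-<-tail : Cover a c → Path c C b → x ∈ˡ C → ∣ a ∣ < ∣ x ∣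
  Path-<-tail r p x∈ = ≤-trans (Cover-< r) (Path-start-≤ p x∈)

  ∉-tail : Cover a c → Path c C b → ¬ (a ∈ˡ C)
  ∉-tail r p a∈ = <-irrefl refl (Path-<-tail r p a∈)

  ∉-init : Path a C c → Cover c b → ¬ (b ∈ˡ C)
  ∉-init p r b∈ = <-irrefl refl (≤-trans (Cover-< r) (Path-end-≤ p b∈))

  Path-⊆ : Path a C b → x ∈ˡ C → y ∈ˡ C → ∣ x ∣ ≤ ∣ y ∣ → x ⊆ y
  Path-⊆ [-]     (here refl) (here refl) _  = ⊆-refl
  Path-⊆ (r ∷ p) (here refl) y∈          _  = Path-start-⊆ (r ∷ p) y∈
  Path-⊆ (r ∷ p) (there x∈)  (here refl) le = contradiction le (ℕ.<⇒≱ (Path-<-tail r p x∈))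
  Path-⊆ (r ∷ p) (there x∈)  (there y∈)  le = Path-⊆ p x∈ y∈ le

  Path-size-injective : Path a C b → x ∈ˡ C → y ∈ˡ C → ∣ x ∣ ≡ ∣ y ∣ → x ≡ y
  Path-size-injective p x∈ y∈ eq =
    ⊆-antisym (Path-⊆ p x∈ y∈ (ℕ.≤-reflexive eq)) (Path-⊆ p y∈ x∈ (ℕ.≤-reflexive (sym eq)))

  Path-size-surjective : ∀ {r} → Path a C b → ∣ a ∣ ≤ r → r ≤ ∣ b ∣ → ∃[ x ] (x ∈ˡ C × ∣ x ∣ ≡ r)
  Path-size-surjective [-] l u = _ , here refl , ℕ.≤-antisym l u
  Path-size-surjective {a} {r = r} (c ∷ p) l u with ∣ a ∣ ℕ.≟ r
  ... | yes eq = _ , here refl , eq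
  ... | no neq =
    let x , x∈ , eq = Path-size-surjective p (subst (_≤ r) (sym (proj₂ c)) (ℕ.≤∧≢⇒< l neq)) u
    in x , there x∈ , eq

  Path-length : Path a C b → ∣ a ∣ + length C ≡ suc ∣ b ∣
  Path-length {a} [-] = ℕ.+-comm ∣ a ∣ 1
  Path-length {a} (_∷_ {ys = ys} (_ , eq) p) =
    trans (+-suc ∣ a ∣ (length ys)) (trans (cong (_+ length ys) (sym eq)) (Path-length p))

  Path-AllPairs-< : Path a C b → AllPairs (λ x y → ∣ x ∣ < ∣ y ∣) C
  Path-AllPairs-< [-]     = [] ∷ []
  Path-AllPairs-< (r ∷ p) = All.tabulate (Path-<-tail r p) ∷ Path-AllPairs-< p

  Path⇒Linked : Path a C b → Linked Cover C
  Path⇒Linked [-]           = [-]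
  Path⇒Linked (r ∷ [-])     = r ∷ [-]
  Path⇒Linked (r ∷ (s ∷ p)) = r ∷ Path⇒Linked (s ∷ p)

  Linked⇒Path : Linked Cover (x ∷ C) → ∃[ b ] Path x (x ∷ C) b
  Linked⇒Path [-]     = _ , [-]
  Linked⇒Path (r ∷ l) = let b , p = Linked⇒Path l in b , r ∷ p

  joinPath : Path a C b → Cover b x → Path x D y → Path a (C ++ D) y
  joinPath [-]     r q = r ∷ q
  joinPath (s ∷ p) r q = s ∷ joinPath p r q

  data Unsnoc (a : Subset n) : Chain n → Subset n → Set where
    single : Unsnoc a [ a ] a
    snoc   : ∀ {C b′ b} → Path a C b′ → Cover b′ b → Unsnoc a (C ∷ʳ b) b

  unsnoc : Path a C b → Unsnoc a C b
  unsnoc [-] = single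
  unsnoc (r ∷ p) with unsnoc p
  ... | single   = snoc [-] r
  ... | snoc q s = snoc (r ∷ q) s

  -- One list peeled at its left end and at its right end; the equation ties the two peelings
  -- together, for grids that are cut at both ends of a side.
  data BothEnds : Subset n → Chain n → Subset n → Set where
    bothEnds : ∀ {x x₁ z′ z L L′} → Cover x x₁ → Path x₁ L z → Path x L′ z′ → Cover z′ z →
      x ∷ L ≡ L′ ∷ʳ z → BothEnds x (x ∷ L) z

  viewBothEnds : Path a C b → 2 ≤ length C → BothEnds a C b
  viewBothEnds [-] (s≤s ())
  viewBothEnds (r ∷ p) _ with unsnoc p
  ... | single   = bothEnds r [-] [-] r refl
  ... | snoc q s = bothEnds r p (r ∷ q) s refl

  SymChain⇒SymPath : IsSymChain n C → SymPath n C
  SymChain⇒SymPath {C = x ∷ C} (l , _ , _ , refl , refl , eq) with b , p ← Linked⇒Path l =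
    x , b , p , ℕ.suc-injective (begin
      suc (∣ x ∣ + ∣ b ∣)            ≡⟨ +-suc ∣ x ∣ ∣ b ∣ ⟨
      ∣ x ∣ + suc ∣ b ∣              ≡⟨ cong (∣ x ∣ +_) (Path-length p) ⟨
      ∣ x ∣ + (∣ x ∣ + suc (length C)) ≡⟨ ℕ.+-assoc ∣ x ∣ ∣ x ∣ _ ⟨
      ∣ x ∣ + ∣ x ∣ + suc (length C) ≡⟨ eq ⟩
      suc n                          ∎)
    where open ≡-Reasoning

  SymPath⇒SymChain : SymPath n C → IsSymChain n C
  SymPath⇒SymChain {C = C} (a , b , p , eq) =
    Path⇒Linked p , ∣ a ∣ , a , head≡ p , refl , (begin
      ∣ a ∣ + ∣ a ∣ + length C   ≡⟨ ℕ.+-assoc ∣ a ∣ ∣ a ∣ _ ⟩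
      ∣ a ∣ + (∣ a ∣ + length C) ≡⟨ cong (∣ a ∣ +_) (Path-length p) ⟩
      ∣ a ∣ + suc ∣ b ∣          ≡⟨ +-suc ∣ a ∣ ∣ b ∣ ⟩
      suc (∣ a ∣ + ∣ b ∣)        ≡⟨ cong suc eq ⟩
      suc n                      ∎)
    where
    open ≡-Reasoning
    head≡ : Path a C b → head C ≡ just a
    head≡ [-]     = refl
    head≡ (_ ∷ _) = refl

  -- The sizes fill the interval from `∣ a ∣` to `∣ b ∣`, which the reflection of r to n - r
  -- preserves. The witness lies as far above `a` as `x` lies below `b`.
  SymPath-mirror : SymPath n C → x ∈ˡ C → ∃[ y ] (y ∈ˡ C × ∣ x ∣ + ∣ y ∣ ≡ n)
  SymPath-mirror {x = x} (a , b , p , eq) x∈ =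
    let l , x+l≡b = ℕ.m≤n⇒∃[o]m+o≡n (Path-end-≤ p x∈)
        r≤b : ∣ a ∣ + l ≤ ∣ b ∣
        r≤b = subst (∣ a ∣ + l ≤_) x+l≡b (ℕ.+-monoˡ-≤ l (Path-start-≤ p x∈))
        y , y∈ , ≡r = Path-size-surjective p (ℕ.m≤m+n ∣ a ∣ l) r≤b
    in y , y∈ , (begin
      ∣ x ∣ + ∣ y ∣       ≡⟨ cong (∣ x ∣ +_) ≡r ⟩
      ∣ x ∣ + (∣ a ∣ + l) ≡⟨ ℕ.+-assoc ∣ x ∣ ∣ a ∣ l ⟨
      ∣ x ∣ + ∣ a ∣ + l   ≡⟨ cong (_+ l) (ℕ.+-comm ∣ x ∣ ∣ a ∣) ⟩
      ∣ a ∣ + ∣ x ∣ + l   ≡⟨ ℕ.+-assoc ∣ a ∣ ∣ x ∣ l ⟩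
      ∣ a ∣ + (∣ x ∣ + l) ≡⟨ cong (∣ a ∣ +_) x+l≡b ⟩
      ∣ a ∣ + ∣ b ∣       ≡⟨ eq ⟩
      n                   ∎)
    where open ≡-Reasoning

-- Almost orthogonality as a condition on pairs of common elements

MeetsOnlyAtEnds : (n : ℕ) → Family n → Family n → Set
MeetsOnlyAtEnds n F G = ∀ {A B x y} → A ∈ˡ F → B ∈ˡ G →
  x ∈ˡ A → x ∈ˡ B → y ∈ˡ A → y ∈ˡ B → ∣ x ∣ < ∣ y ∣ → x ≡ ⊥ × y ≡ ⊤

module _ {n : ℕ} (1≤n : 1 ≤ n) where

  private
    module _ {X : Set} where

      2≤length : ∀ {L : List X} {p q} → p ∈ˡ L → q ∈ˡ L → p ≢ q → 2 ≤ length L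
      2≤length {_ ∷ _ ∷ _} _           _           _   = s≤s (s≤s z≤n)
      2≤length {_ ∷ []}    (here refl) (here refl) neq = contradiction refl neq

      ∈-pair : ∀ {L : List X} {p q x} → length L ≡ 2 → p ∈ˡ L → q ∈ˡ L → p ≢ q →
        x ∈ˡ L → x ≡ p ⊎ x ≡ q
      ∈-pair {_ ∷ _ ∷ []} _ (here refl)         (here refl)         neq _ = contradiction refl neq
      ∈-pair {_ ∷ _ ∷ []} _ (there (here refl)) (there (here refl)) neq _ = contradiction refl neq
      ∈-pair {_ ∷ _ ∷ []} _ (here refl) (there (here refl)) _ (here refl)         = inj₁ refl
      ∈-pair {_ ∷ _ ∷ []} _ (here refl) (there (here refl)) _ (there (here refl)) = inj₂ refl
      ∈-pair {_ ∷ _ ∷ []} _ (there (here refl)) (here refl) _ (here refl)         = inj₂ refl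
      ∈-pair {_ ∷ _ ∷ []} _ (there (here refl)) (here refl) _ (there (here refl)) = inj₁ refl

    containsBoth? : (A : Chain n) → Dec (ContainsBoth A)
    containsBoth? A = any? (⊥ ≟ˢ_) A ×-dec any? (⊤ ≟ˢ_) A

  -- Unless both chains contain `⊥` and `⊤`, two common elements exceed the bound 1. If they do, `⊥`
  -- and `⊤` fill the two places of the intersection, and the sizes tell which is which.
  AlmostOrthogonal⇒MeetsOnlyAtEnds : ∀ {F G} → AlmostOrthogonal n F G → MeetsOnlyAtEnds n F G
  AlmostOrthogonal⇒MeetsOnlyAtEnds ao {A} {B} {x} {y} A∈ B∈ x∈A x∈B y∈A y∈B x<y
    with containsBoth? A ×-dec containsBoth? B
  ... | no ¬both = contradiction (proj₂ (ao A B A∈ B∈) ¬both)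
                     (ℕ.<⇒≱ (2≤length (∈-filter⁺ _ x∈A x∈B) (∈-filter⁺ _ y∈A y∈B) x≢y))
    where
    x≢y : x ≢ y
    x≢y refl = <-irrefl refl x<y
  ... | yes both@((⊥∈A , ⊤∈A) , (⊥∈B , ⊤∈B)) =
        conclude (end x∈A x∈B) (end y∈A y∈B)
    where
    end : ∀ {z} → z ∈ˡ A → z ∈ˡ B → z ≡ ⊥ ⊎ z ≡ ⊤
    end z∈A z∈B = ∈-pair (proj₁ (ao A B A∈ B∈) both)
      (∈-filter⁺ _ ⊥∈A ⊥∈B) (∈-filter⁺ _ ⊤∈A ⊤∈B) (⊥≢⊤ 1≤n) (∈-filter⁺ _ z∈A z∈B)
    conclude : x ≡ ⊥ ⊎ x ≡ ⊤ → y ≡ ⊥ ⊎ y ≡ ⊤ → x ≡ ⊥ × y ≡ ⊤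
    conclude (inj₁ x≡⊥)  (inj₂ y≡⊤)  = x≡⊥ , y≡⊤
    conclude _           (inj₁ refl) = contradiction (subst (∣ x ∣ <_) (∣⊥∣≡0 n) x<y) λ ()
    conclude (inj₂ refl) (inj₂ refl) = contradiction x<y (<-irrefl refl)

  MeetsOnlyAtEnds⇒AlmostOrthogonal : ∀ {F G} → (∀ A → A ∈ˡ F → SymPath n A) →
    MeetsOnlyAtEnds n F G → AlmostOrthogonal n F G
  MeetsOnlyAtEnds⇒AlmostOrthogonal symF meets A B A∈ B∈ =
    let _ , _ , p , _ = symF A A∈
        both , notBoth = bounds (AllPairs.filter⁺ _ (Path-AllPairs-< p)) λ x∈ y∈ →
          let x∈A , x∈B = ∈-filter⁻ _ x∈
              y∈A , y∈B = ∈-filter⁻ _ y∈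
          in meets A∈ B∈ x∈A x∈B y∈A y∈B
    in (λ ((⊥∈A , ⊤∈A) , (⊥∈B , ⊤∈B)) → both (∈-filter⁺ _ ⊥∈A ⊥∈B) (∈-filter⁺ _ ⊤∈A ⊤∈B))
     , λ ¬both → notBoth λ (⊥∈ , ⊤∈) →
         let ⊥∈A , ⊥∈B = ∈-filter⁻ _ ⊥∈
             ⊤∈A , ⊤∈B = ∈-filter⁻ _ ⊤∈
         in ¬both ((⊥∈A , ⊤∈A) , (⊥∈B , ⊤∈B))
    where
    bounds : ∀ {L : Chain n} → AllPairs (λ x y → ∣ x ∣ < ∣ y ∣) L →
      (∀ {x y} → x ∈ˡ L → y ∈ˡ L → ∣ x ∣ < ∣ y ∣ → x ≡ ⊥ × y ≡ ⊤) →
      (⊥ ∈ˡ L → ⊤ ∈ˡ L → length L ≡ 2) × (¬ (⊥ ∈ˡ L × ⊤ ∈ˡ L) → length L ≤ 1)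
    bounds {[]} _ _ = (λ ()) , λ _ → z≤n
    bounds {_ ∷ []} _ _ = (λ { (here eq) (here eq′) → contradiction (trans eq (sym eq′)) (⊥≢⊤ 1≤n) }) , λ _ → s≤s z≤n
    bounds {x ∷ y ∷ []} ((x<y ∷ _) ∷ _) meets =
      (λ _ _ → refl) , λ ¬both → case meets (here refl) (there (here refl)) x<y of λ where
        (x≡⊥ , y≡⊤) → contradiction (here (sym x≡⊥) , there (here (sym y≡⊤))) ¬both
    -- Of three elements of increasing size, the middle one would be `⊤` in the first pair and `⊥`
    -- in the second.
    bounds {x ∷ y ∷ z ∷ _} ((x<y ∷ _) ∷ (y<z ∷ _) ∷ _) meets =
      contradiction
        (trans (sym (proj₁ (meets (there (here refl)) (there (there (here refl))) y<z)))
               (proj₂ (meets (here refl) (there (here refl)) x<y)))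
        (⊥≢⊤ 1≤n)

-- Products of lists and of subset lattices

private
  module ↭-Solver {Z : Set} where
    open CommutativeMonoidSolver (++-commutativeMonoid {A = Z}) public

module _ {X Y Z : Set} (f : X → Y → Z) where

  private
    _×ᶠ_ = cartesianProductWith f

  productWith-[-] : ∀ A c → A ×ᶠ [ c ] ≡ map (λ a → f a c) A
  productWith-[-] []      c = refl
  productWith-[-] (a ∷ A) c = cong (f a c ∷_) (productWith-[-] A c)

  productWith-++ʳ : ∀ A C D → A ×ᶠ (C ++ D) ↭ A ×ᶠ C ++ A ×ᶠ D
  productWith-++ʳ []      C D = ↭-refl
  productWith-++ʳ (a ∷ A) C D = begin
    map (f a) (C ++ D) ++ A ×ᶠ (C ++ D)
      ↭⟨ ↭.++⁺ (↭-reflexive (map-++ (f a) C D)) (productWith-++ʳ A C D) ⟩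
    (map (f a) C ++ map (f a) D) ++ (A ×ᶠ C ++ A ×ᶠ D)
      ↭⟨ solve 4 (λ p q r s → (p ⊕ q) ⊕ (r ⊕ s) ⊜ (p ⊕ r) ⊕ (q ⊕ s)) ↭-refl
           (map (f a) C) (map (f a) D) (A ×ᶠ C) (A ×ᶠ D) ⟩
    (map (f a) C ++ A ×ᶠ C) ++ (map (f a) D ++ A ×ᶠ D) ∎
    where
    open PermutationReasoning
    open ↭-Solver

  productWith-∷ʳ : ∀ A C c → A ×ᶠ (C ∷ʳ c) ↭ A ×ᶠ C ++ map (λ a → f a c) A
  productWith-∷ʳ A C c =
    ↭-trans (productWith-++ʳ A C [ c ]) (↭.++⁺ˡ (A ×ᶠ C) (↭-reflexive (productWith-[-] A c)))

productWith-flip : ∀ {X Y Z : Set} (f : X → Y → Z) A C →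
  cartesianProductWith (flip f) C A ↭ cartesianProductWith f A C
productWith-flip f A []      = ↭-reflexive (sym (cartesianProductWith-zeroʳ f A))
productWith-flip f A (c ∷ C) = ↭-trans
  (↭.++⁺ (↭-reflexive (sym (productWith-[-] f A c))) (productWith-flip f A C))
  (↭-sym (productWith-++ʳ f A [ c ] C))

-- The permutation keeps multiplicities, so covering and uniqueness both pass from the product to
-- the tiles.
Tiling : ∀ {X Y Z : Set} → (X → Y → Z) → List X → List Y → (List Z → Set) → Set
Tiling f A C Q = ∃[ D ] (concat D ↭ cartesianProductWith f A C × (∀ X → X ∈ˡ D → Q X))

module _ {X Y Z : Set} {f : X → Y → Z} {Q : List Z → Set} where

  private
    concat-cong : ∀ D E {P R : List Z} → concat D ↭ P → concat E ↭ R → concat (D ++ E) ↭ P ++ R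
    concat-cong D E p r = ↭-trans (↭-reflexive (sym (concat-++ D E))) (↭.++⁺ p r)

    all-++ : ∀ D {E : List (List Z)} → (∀ W → W ∈ˡ D → Q W) → (∀ W → W ∈ˡ E → Q W) → ∀ W → W ∈ˡ D ++ E → Q W
    all-++ D q r W W∈ with ∈-++⁻ D W∈
    ... | inj₁ W∈D = q W W∈D
    ... | inj₂ W∈E = r W W∈E

  tiling-concatʳ : ∀ A Cs → (∀ C → C ∈ˡ Cs → Tiling f A C Q) → Tiling f A (concat Cs) Q
  tiling-concatʳ A []       _ = [] , ↭-reflexive (sym (cartesianProductWith-zeroʳ f A)) , λ _ ()
  tiling-concatʳ A (C ∷ Cs) t =
    let D , perm , q = t C (here refl)
        E , perm′ , r = tiling-concatʳ A Cs (λ C′ → t C′ ∘ there)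
    in D ++ E , ↭-trans (concat-cong D E perm perm′) (↭-sym (productWith-++ʳ f A C (concat Cs))) , all-++ D q r

  tiling-concatˡ : ∀ As C → (∀ A → A ∈ˡ As → Tiling f A C Q) → Tiling f (concat As) C Q
  tiling-concatˡ []       C _ = [] , ↭-refl , λ _ ()
  tiling-concatˡ (A ∷ As) C t =
    let D , perm , q = t A (here refl)
        E , perm′ , r = tiling-concatˡ As C (λ A′ → t A′ ∘ there)
    in D ++ E ,
       ↭-trans (concat-cong D E perm perm′)
         (↭-reflexive (sym (cartesianProductWith-distribʳ-++ f A (concat As) C))) ,
       all-++ D q r

-- Abstracts from concatenation so that the transposed product is an instance too and results on
-- rows yield results on columns. With `sum` as an equation, transposition keeps the same `N`.
record Product (m n N : ℕ) : Set where
  infixr 6 _⊗_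
  field
    _⊗_     : Subset m → Subset n → Subset N
    sum     : m + n ≡ N
    size    : ∀ S T → ∣ S ⊗ T ∣ ≡ ∣ S ∣ + ∣ T ∣
    mono    : ∀ {S S′ T T′} → S ⊆ S′ → T ⊆ T′ → S ⊗ T ⊆ S′ ⊗ T′
    reflect : ∀ {S S′ T T′} → S ⊗ T ⊆ S′ ⊗ T′ → S ⊆ S′ × T ⊆ T′

  injective : ∀ {S S′ T T′} → S ⊗ T ≡ S′ ⊗ T′ → S ≡ S′ × T ≡ T′
  injective eq =
    let S⊆ , T⊆ = reflect (⊆-reflexive eq)
        S⊇ , T⊇ = reflect (⊆-reflexive (sym eq))
    in ⊆-antisym S⊆ S⊇ , ⊆-antisym T⊆ T⊇

  coverˡ : ∀ {S S′} T → Cover S S′ → Cover (S ⊗ T) (S′ ⊗ T)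
  coverˡ {S} {S′} T (S⊆ , eq) =
    mono S⊆ ⊆-refl , trans (size S′ T) (trans (cong (_+ ∣ T ∣) eq) (cong suc (sym (size S T))))

  coverʳ : ∀ S {T T′} → Cover T T′ → Cover (S ⊗ T) (S ⊗ T′)
  coverʳ S {T} {T′} (T⊆ , eq) =
    mono ⊆-refl T⊆ , trans (size S T′) (trans (cong (∣ S ∣ +_) eq) (trans (+-suc ∣ S ∣ ∣ T ∣) (cong suc (sym (size S T)))))

  row : Chain m → Subset n → Chain N
  row A t = map (_⊗ t) A

  column : Subset m → Chain n → Chain N
  column s C = map (s ⊗_) C

  row-path : ∀ {a A b} t → Path a A b → Path (a ⊗ t) (row A t) (b ⊗ t)
  row-path t [-]     = [-]
  row-path t (r ∷ p) = coverˡ t r ∷ row-path t p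

  column-path : ∀ {c C d} s → Path c C d → Path (s ⊗ c) (column s C) (s ⊗ d)
  column-path s [-]     = [-]
  column-path s (r ∷ p) = coverʳ s r ∷ column-path s p

  ∈-row : ∀ {A s t t′} → s ⊗ t ∈ˡ row A t′ → s ∈ˡ A × t ≡ t′
  ∈-row {A} s⊗t∈ with _ , s∈ , eq ← ∈-map⁻ _ s⊗t∈ with refl , refl ← injective eq = s∈ , refl

  ∈-column : ∀ {C s s′ t} → s ⊗ t ∈ˡ column s′ C → s ≡ s′ × t ∈ˡ C
  ∈-column s⊗t∈ with _ , t∈ , eq ← ∈-map⁻ _ s⊗t∈ with refl , refl ← injective eq = refl , t∈

  _⊠_ : Chain m → Chain n → Chain N
  A ⊠ C = cartesianProductWith _⊗_ A C

  ∈-⊠ : ∀ {A C s t} → s ⊗ t ∈ˡ A ⊠ C → s ∈ˡ A × t ∈ˡ C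
  ∈-⊠ {A} {C} s⊗t∈ with _ , _ , s∈ , t∈ , eq ← ∈-cartesianProductWith⁻ _⊗_ A C s⊗t∈
    with refl , refl ← injective eq = s∈ , t∈

swap : Product m n N → Product n m N
swap {m} {n} P = record
  { _⊗_     = flip _⊗_
  ; sum     = trans (ℕ.+-comm n m) sum
  ; size    = λ T S → trans (size S T) (ℕ.+-comm ∣ S ∣ ∣ T ∣)
  ; mono    = flip mono
  ; reflect = λ le → let S⊆ , T⊆ = reflect le in T⊆ , S⊆
  } where open Product P

concatenation : ∀ m n → Product m n (m + n)
concatenation m n = record
  { _⊗_ = Vec._++_ ; sum = refl ; size = size ; mono = mono ; reflect = reflect _ _ }
  where
  size : ∀ {m} (S : Subset m) (T : Subset n) → ∣ S Vec.++ T ∣ ≡ ∣ S ∣ + ∣ T ∣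
  size Vec.[]              T = refl
  size (inside  Vec.∷ S) T = cong suc (size S T)
  size (outside Vec.∷ S) T = size S T

  mono : ∀ {m} {S S′ : Subset m} {T T′ : Subset n} → S ⊆ S′ → T ⊆ T′ → S Vec.++ T ⊆ S′ Vec.++ T′
  mono {S = Vec.[]}      {Vec.[]}       S⊆ T⊆ = T⊆
  mono {S = s Vec.∷ S} {s′ Vec.∷ S′} S⊆ T⊆ Vec.here with Vec.here ← S⊆ Vec.here = Vec.here
  mono {S = s Vec.∷ S} {s′ Vec.∷ S′} S⊆ T⊆ (Vec.there x∈) = Vec.there (mono {S = S} (drop-∷-⊆ S⊆) T⊆ x∈)

  reflect : ∀ {m} (S S′ : Subset m) {T T′ : Subset n} → S Vec.++ T ⊆ S′ Vec.++ T′ → S ⊆ S′ × T ⊆ T′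
  reflect Vec.[]        Vec.[]          le = (λ ()) , le
  reflect (s Vec.∷ S) (s′ Vec.∷ S′) {T} le = S⊆ , proj₂ rest
    where
    rest = reflect S S′ (drop-∷-⊆ le)
    S⊆ : s Vec.∷ S ⊆ s′ Vec.∷ S′
    S⊆ Vec.here with Vec.here ← le Vec.here = Vec.here
    S⊆ (Vec.there x∈) = Vec.there (proj₁ rest x∈)

-- Decompositions of grids into symmetric chains

-- Peeling off a hook raises the lower end of one side and lowers the upper end of the other, so the
-- remaining grid stays centred in the same lattice.
shift-sum : ∀ {a a′ b c d d′ : ℕ} → a′ ≡ suc a → d ≡ suc d′ → a′ + b + (c + d′) ≡ a + b + (c + d)
shift-sum {a} {b = b} {c} {d′ = d′} refl refl = lemma a b c d′
  where
  lemma : ∀ a b c d′ → suc a + b + (c + d′) ≡ a + b + (c + suc d′)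
  lemma = solve-∀

module _ {m n N : ℕ} (P : Product m n N) where
  open Product P

  private variable
    a b : Subset m
    c d : Subset n
    A   : Chain m
    C   : Chain n

  -- The clause `a ≢ b` sets aside the one-element side, where every element of the tile would count
  -- as spanning its row.
  SpansOnlyRow : Subset m → Subset m → Subset n → Chain N → Set
  SpansOnlyRow a b t X = ∀ {t′} → a ⊗ t′ ∈ˡ X → b ⊗ t′ ∈ˡ X → a ≢ b → t′ ≡ t

  SpansOnlyColumn : Subset n → Subset n → Subset m → Chain N → Set
  SpansOnlyColumn c d s X = ∀ {s′} → s′ ⊗ c ∈ˡ X → s′ ⊗ d ∈ˡ X → c ≢ d → s′ ≡ s

  NoRow : Subset m → Subset m → Chain N → Set
  NoRow a b X = ∀ {t} → a ⊗ t ∈ˡ X → ¬ (b ⊗ t ∈ˡ X)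

  NoColumn : Subset n → Subset n → Chain N → Set
  NoColumn c d X = ∀ {s} → s ⊗ c ∈ˡ X → ¬ (s ⊗ d ∈ˡ X)

  size-ends : ∀ a b c d → ∣ a ∣ + ∣ b ∣ + (∣ c ∣ + ∣ d ∣) ≡ N → ∣ a ⊗ c ∣ + ∣ b ⊗ d ∣ ≡ N
  size-ends a b c d eq =
    trans (cong₂ _+_ (size a c) (size b d)) (trans (interchange (∣ a ∣) (∣ c ∣) (∣ b ∣) (∣ d ∣)) eq)
    where
    interchange : ∀ a c b d → a + c + (b + d) ≡ a + b + (c + d)
    interchange = solve-∀

  tile-⊠ : ∀ A C {D X s t} → concat D ↭ A ⊠ C → X ∈ˡ D → s ⊗ t ∈ˡ X → s ∈ˡ A × t ∈ˡ C
  tile-⊠ _ _ perm X∈ st∈ = ∈-⊠ (∈-resp-↭ perm (∈-concat⁺′ st∈ X∈))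

  -- The hook {a} × C ∪ A × {d} is peeled off first; every other chain avoids a and d,
  -- so it misses an end of each row and of each column.
  standardTiling : Path a A b → Path c C d → ∣ a ∣ + ∣ b ∣ + (∣ c ∣ + ∣ d ∣) ≡ N →
    Tiling _⊗_ A C λ X → SymPath N X × SpansOnlyRow a b d X × SpansOnlyColumn c d a X
  standardTiling {a} {c = c} {C} {d} [-] q eq =
    column a C ∷ [] , ↭-refl , λ where
      _ (here refl) →
        (a ⊗ c , a ⊗ d , column-path a q , size-ends a a c d eq) ,
        (λ _ _ a≢a → contradiction refl a≢a) ,
        (λ sc∈ _ _ → proj₁ (∈-column sc∈))
  standardTiling {a} {A = A} {b = b} {c = c} {C} {d} p@(_∷_ {y = a′} {ys = A′} r p′) q eq with unsnoc q
  ... | single =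
    row A c ∷ [] , ↭-reflexive (trans (++-identityʳ (row A c)) (sym (productWith-[-] _⊗_ A c))) , λ where
      _ (here refl) →
        (a ⊗ c , b ⊗ c , row-path c p , size-ends a b c c eq) ,
        (λ at∈ _ _ → proj₂ (∈-row at∈)) ,
        (λ _ _ c≢c → contradiction refl c≢c)
  ... | snoc {C = C′} {b′ = d′} q′ s
    with D , perm , good ← standardTiling p′ q′ (trans (shift-sum {b = ∣ b ∣} {∣ c ∣} (proj₂ r) (proj₂ s)) eq) =
    hook ∷ D , perm′ , λ where
      _ (here refl) →
        (a ⊗ c , b ⊗ d , joinPath (column-path a q′) (coverʳ a s) (row-path d p) , size-ends a b c d eq) ,
        hook-row , hook-column
      X (there X∈) → let sym-X , _ , _ = good X X∈ in
        sym-X ,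
        (λ at∈ _ _ → contradiction (proj₁ (tile-⊠ A′ C′ perm X∈ at∈)) (∉-tail r p′)) ,
        (λ _ sd∈ _ → contradiction (proj₂ (tile-⊠ A′ C′ perm X∈ sd∈)) (∉-init q′ s))
    where
    hook = column a C′ ++ row A d

    perm′ : hook ++ concat D ↭ A ⊠ (C′ ∷ʳ d)
    perm′ = begin
      (column a C′ ++ row A d) ++ concat D   ↭⟨ ↭.++⁺ˡ hook perm ⟩
      (column a C′ ++ row A d) ++ A′ ⊠ C′
        ↭⟨ solve 3 (λ x y z → (x ⊕ y) ⊕ z ⊜ (x ⊕ z) ⊕ y) ↭-refl (column a C′) (row A d) (A′ ⊠ C′) ⟩
      (column a C′ ++ A′ ⊠ C′) ++ row A d    ↭⟨ productWith-∷ʳ _⊗_ A C′ d ⟨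
      A ⊠ (C′ ∷ʳ d)                          ∎
      where
      open PermutationReasoning
      open ↭-Solver

    hook-row : SpansOnlyRow a b d hook
    hook-row _ bt∈ a≢b with ∈-++⁻ (column a C′) bt∈
    ... | inj₁ bt∈ = contradiction (sym (proj₁ (∈-column bt∈))) a≢b
    ... | inj₂ bt∈ = proj₂ (∈-row bt∈)

    hook-column : SpansOnlyColumn c d a hook
    hook-column sc∈ _ c≢d with ∈-++⁻ (column a C′) sc∈
    ... | inj₁ sc∈ = proj₁ (∈-column sc∈)
    ... | inj₂ sc∈ = contradiction (proj₂ (∈-row sc∈)) c≢d

  -- In coordinates a = 0, …, p = b of A and c = 0, …, q = d of C (p, q ≥ 2), the chains are
  --   long:   (0,0), (1,0), …, (1,q-1), (2,q-1), …, (p,q-1), (p,q)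
  --   second: (0,1), …, (0,q), (1,q), …, (p-1,q)
  -- and the standard tiling of the remaining grid [2..p] × [0..q-2].
  module SpanFree
    {a a₁ a₂ b′ b : Subset m} {A′ M′ : Chain m}
    (a⋖a₁ : Cover a a₁) (a₁⋖a₂ : Cover a₁ a₂) (pA′ : Path a₂ A′ b)
    (pM′ : Path a₁ M′ b′) (b′⋖b : Cover b′ b) (M≡ : a₁ ∷ A′ ≡ M′ ∷ʳ b)
    {c c₁ e′ e d : Subset n} {E′ C′ : Chain n}
    (c⋖c₁ : Cover c c₁) (pE′ : Path c₁ E′ e) (e⋖d : Cover e d)
    (pC′ : Path c C′ e′) (e′⋖e : Cover e′ e) (E≡ : c ∷ E′ ≡ C′ ∷ʳ e)
    (total : ∣ a ∣ + ∣ b ∣ + (∣ c ∣ + ∣ d ∣) ≡ N)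
    where

    M = a₁ ∷ A′
    E = c ∷ E′

    pM : Path a₁ M b
    pM = a₁⋖a₂ ∷ pA′

    long second : Chain N
    long   = a ⊗ c ∷ column a₁ C′ ++ row M e ++ [ b ⊗ d ]
    second = column a (E′ ∷ʳ d) ++ row M′ d

    a≢b : a ≢ b
    a≢b refl = ∉-tail a⋖a₁ pM (Path-end pM)

    a₁≢b : a₁ ≢ b
    a₁≢b refl = ∉-tail a₁⋖a₂ pA′ (Path-end pA′)

    c≢e : c ≢ e
    c≢e refl = ∉-tail c⋖c₁ pE′ (Path-end pE′)

    pE′d : Path c₁ (E′ ∷ʳ d) d
    pE′d = joinPath pE′ e⋖d [-]

    c≢d : c ≢ d
    c≢d refl = ∉-tail c⋖c₁ pE′d (Path-end pE′d)

    e≢d : e ≢ d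
    e≢d refl = <-irrefl refl (Cover-< e⋖d)

    d∉C′ : ¬ (d ∈ˡ C′)
    d∉C′ d∈ = ∉-init (c⋖c₁ ∷ pE′) e⋖d (subst (d ∈ˡ_) (sym E≡) (∈-++⁺ˡ d∈))

    long-sym : SymPath N long
    long-sym = a ⊗ c , b ⊗ d ,
      coverˡ c a⋖a₁ ∷ joinPath (column-path a₁ pC′) (coverʳ a₁ e′⋖e) (joinPath (row-path e pM) (coverʳ b e⋖d) [-]) ,
      size-ends a b c d total

    data ∈Long (s : Subset m) (t : Subset n) : Set where
      first  : s ≡ a → t ≡ c → ∈Long s t
      rise   : s ≡ a₁ → t ∈ˡ C′ → ∈Long s t
      across : s ∈ˡ M → t ≡ e → ∈Long s t
      final  : s ≡ b → t ≡ d → ∈Long s t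

    ∈-long : ∀ {s t} → s ⊗ t ∈ˡ long → ∈Long s t
    ∈-long (here eq) = let s≡ , t≡ = injective eq in first s≡ t≡
    ∈-long (there st∈) with ∈-++⁻ (column a₁ C′) st∈
    ... | inj₁ st∈ = let s≡ , t∈ = ∈-column st∈ in rise s≡ t∈
    ... | inj₂ st∈ with ∈-++⁻ (row M e) st∈
    ...   | inj₁ st∈ = let s∈ , t≡ = ∈-row st∈ in across s∈ t≡
    ...   | inj₂ (here eq) = let s≡ , t≡ = injective eq in final s≡ t≡

    -- Only the first element of `long` has left coordinate `a`, and only the last has right
    -- coordinate `d`. A full row or a full column would therefore contain this corner.
    long-bc : ¬ (∈Long b c)
    long-bc (first b≡a _)   = a≢b (sym b≡a)
    long-bc (rise b≡a₁ _)   = a₁≢b (sym b≡a₁)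
    long-bc (across _ c≡e)  = c≢e c≡e
    long-bc (final _ c≡d)   = c≢d c≡d

    long-row : NoRow a b long
    long-row at∈ bt∈ with ∈-long at∈
    ... | first _ refl = long-bc (∈-long bt∈)
    ... | rise refl _  = ∉-tail a⋖a₁ pM (here refl)
    ... | across a∈M _ = ∉-tail a⋖a₁ pM a∈M
    ... | final a≡b _  = a≢b a≡b

    long-column : NoColumn c d long
    long-column sc∈ sd∈ with ∈-long sd∈
    ... | first _ d≡c  = c≢d (sym d≡c)
    ... | rise _ d∈C′  = d∉C′ d∈C′
    ... | across _ d≡e = e≢d (sym d≡e)
    ... | final refl _ = long-bc (∈-long sc∈)

    second-sym : SymPath N second
    second-sym = a ⊗ c₁ , b′ ⊗ d ,
      joinPath (column-path a pE′d) (coverˡ d a⋖a₁) (row-path d pM′) ,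
      size-ends a b′ c₁ d (trans (exchange (∣ a ∣) (∣ b′ ∣) (∣ c ∣) (∣ d ∣) (proj₂ b′⋖b) (proj₂ c⋖c₁)) total)
      where
      exchange : ∀ {b c₁} a b′ c d → b ≡ suc b′ → c₁ ≡ suc c → a + b′ + (c₁ + d) ≡ a + b + (c + d)
      exchange a b′ c d refl refl = lemma a b′ c d
        where
        lemma : ∀ a b′ c d → a + b′ + (suc c + d) ≡ a + suc b′ + (c + d)
        lemma = solve-∀

    -- The left coordinate `b` never occurs in `second`, as `M′` stops just before it; likewise the
    -- right coordinate `c` never occurs, which rules out columns.
    second-row : NoRow a b second
    second-row _ bt∈ with ∈-++⁻ (column a (E′ ∷ʳ d)) bt∈
    ... | inj₁ bt∈ = a≢b (sym (proj₁ (∈-column bt∈)))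
    ... | inj₂ bt∈ = ∉-init pM′ b′⋖b (proj₁ (∈-row bt∈))

    second-column : NoColumn c d second
    second-column sc∈ _ with ∈-++⁻ (column a (E′ ∷ʳ d)) sc∈
    ... | inj₁ sc∈ = ∉-tail c⋖c₁ pE′d (proj₂ (∈-column sc∈))
    ... | inj₂ sc∈ = c≢d (proj₂ (∈-row sc∈))

    -- The pieces are regrouped into the column at `a`, the grid `M ⊠ E`, and the rest of the row at
    -- `d`. `M≡` and `E≡` reconcile the two listings of `M` and of `E`.
    perm : ∀ {R} → R ↭ A′ ⊠ C′ → long ++ (second ++ R) ↭ (a ∷ M) ⊠ (E ∷ʳ d)
    perm {R} R↭ = begin
      a ⊗ c ∷ (column a₁ C′ ++ row M e ++ [ b ⊗ d ]) ++ (column a (E′ ∷ʳ d) ++ row M′ d) ++ R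
        ↭⟨ solve 7 (λ z q t w p u r → (z ⊕ q ⊕ t ⊕ w) ⊕ (p ⊕ u) ⊕ r ⊜ (z ⊕ p) ⊕ ((q ⊕ r) ⊕ t) ⊕ (u ⊕ w))
             ↭-refl [ a ⊗ c ] (column a₁ C′) (row M e) [ b ⊗ d ] (column a (E′ ∷ʳ d)) (row M′ d) R ⟩
      column a (E ∷ʳ d) ++ ((column a₁ C′ ++ R) ++ row M e) ++ (row M′ d ++ [ b ⊗ d ])
        ↭⟨ ↭.++⁺ˡ (column a (E ∷ʳ d)) (↭.++⁺
             (↭-trans (↭.++⁺ʳ (row M e) (↭.++⁺ˡ (column a₁ C′) R↭)) (↭-sym (productWith-∷ʳ _⊗_ M C′ e)))
             (↭-reflexive (sym (map-++ (_⊗ d) M′ [ b ])))) ⟩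
      column a (E ∷ʳ d) ++ M ⊠ (C′ ∷ʳ e) ++ row (M′ ∷ʳ b) d
        ≡⟨ cong₂ (λ E M′ → column a (c ∷ E′ ∷ʳ d) ++ M ⊠ E ++ row M′ d) (sym E≡) (sym M≡) ⟩
      column a (E ∷ʳ d) ++ M ⊠ E ++ row M d
        ↭⟨ ↭.++⁺ˡ (column a (E ∷ʳ d)) (productWith-∷ʳ _⊗_ M E d) ⟨
      (a ∷ M) ⊠ (E ∷ʳ d) ∎
      where
      open PermutationReasoning
      open ↭-Solver

    tiling : Tiling _⊗_ (a ∷ M) (E ∷ʳ d) λ X → SymPath N X × NoRow a b X × NoColumn c d X
    tiling with D , D↭ , good ← standardTiling pA′ pC′
                  (trans (shift-sum {b = ∣ b ∣} {∣ c ∣} (proj₂ a₁⋖a₂) (proj₂ e′⋖e))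
                    (trans (shift-sum {b = ∣ b ∣} {∣ c ∣} (proj₂ a⋖a₁) (proj₂ e⋖d)) total))
      = long ∷ second ∷ D , perm D↭ , λ where
          _ (here refl)         → long-sym , (λ {t} → long-row {t}) , λ {s} → long-column {s}
          _ (there (here refl)) → second-sym , (λ {t} → second-row {t}) , λ {s} → second-column {s}
          -- These chains lie in `A′ ⊠ C′`, where neither the left coordinate `a` nor the right
          -- coordinate `d` occurs.
          X (there (there X∈))  → proj₁ (good X X∈) ,
            (λ at∈ _ → ∉-tail a⋖a₁ pM (there (proj₁ (tile-⊠ A′ C′ D↭ X∈ at∈)))) ,
            (λ _ sd∈ → d∉C′ (proj₂ (tile-⊠ A′ C′ D↭ X∈ sd∈)))

  spanFreeTiling : Path a A b → Path c C d → ∣ a ∣ + ∣ b ∣ + (∣ c ∣ + ∣ d ∣) ≡ N →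
    3 ≤ length A → 3 ≤ length C →
    Tiling _⊗_ A C λ X → SymPath N X × NoRow a b X × NoColumn c d X
  spanFreeTiling [-] _ _ (s≤s ()) _
  spanFreeTiling (a⋖a₁ ∷ pM) pC total (s≤s |M|≥2) |C|≥3 with viewBothEnds pM |M|≥2 | unsnoc pC
  spanFreeTiling _ _ _ _ (s≤s ()) | _ | single
  ... | bothEnds a₁⋖a₂ pA′ pM′ b′⋖b M≡ | snoc {C = E} pE e⋖d
    with viewBothEnds pE (ℕ.≤-pred (subst (3 ≤_) (trans (length-++ E) (ℕ.+-comm (length E) 1)) |C|≥3))
  ... | bothEnds c⋖c₁ pE′ pC′ e′⋖e E≡ =
    SpanFree.tiling a⋖a₁ a₁⋖a₂ pA′ pM′ b′⋖b M≡ c⋖c₁ pE′ e⋖d pC′ e′⋖e E≡ total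

-- The elements t of C whose full row may occur in a tile; τ is the tail if C has two elements.
Marked : Subset n → Chain n → Subset n → Set
Marked τ C t = C ≡ [ t ] ⊎ (length C ≡ 2 × t ≡ τ)

-- Full rows and full columns of tiles

module _ {n : ℕ} where

  private variable
    a b : Subset n
    A   : Chain n

  full-ends : Path a A b → ⊥ ∈ˡ A → ⊤ ∈ˡ A → a ≡ ⊥ × b ≡ ⊤
  full-ends {a} {b = b} p ⊥∈ ⊤∈ =
    ∣p∣≡0⇒p≡⊥ (ℕ.n≤0⇒n≡0 (subst (∣ a ∣ ≤_) (∣⊥∣≡0 n) (Path-start-≤ p ⊥∈))) ,
    ∣p∣≡n⇒p≡⊤ (ℕ.≤-antisym (∣p∣≤n b) (subst (_≤ ∣ b ∣) (∣⊤∣≡n n) (Path-end-≤ p ⊤∈)))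

  full-length : Path a A b → ⊥ ∈ˡ A → ⊤ ∈ˡ A → length A ≡ suc n
  full-length {A = A} p ⊥∈ ⊤∈ with refl , refl ← full-ends p ⊥∈ ⊤∈ =
    trans (cong (_+ length A) (sym (∣⊥∣≡0 n))) (trans (Path-length p) (cong suc (∣⊤∣≡n n)))

module _ {m n N : ℕ} (P : Product m n N) where
  open Product P

  private variable
    a b : Subset m
    c d : Subset n
    A   : Chain m
    C   : Chain n

  -- For C = {c < d}, transposing the standard tiling moves the full row from d to c.
  narrowTiling : ∀ {τ} → Path a A b → Path c C d → ∣ a ∣ + ∣ b ∣ + (∣ c ∣ + ∣ d ∣) ≡ N →
    length C ≤ 2 → (length C ≡ 2 → τ ∈ˡ C) →
    Tiling _⊗_ A C λ X → SymPath N X × (∀ {t} → a ≢ b → a ⊗ t ∈ˡ X → b ⊗ t ∈ˡ X → Marked τ C t)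
  narrowTiling p [-] total _ _ with D , D↭ , good ← standardTiling P p [-] total =
    D , D↭ , λ X X∈ → let sym-X , row , _ = good X X∈ in
      sym-X , λ a≢b at∈ bt∈ → inj₁ (cong [_] (sym (row at∈ bt∈ a≢b)))
  narrowTiling {a = a} {A} {b} {c} {C} {d} p q@(_ ∷ [-]) total _ τ∈C with τ∈C refl
  ... | there (here refl) with D , D↭ , good ← standardTiling P p q total =
    D , D↭ , λ X X∈ → let sym-X , row , _ = good X X∈ in
      sym-X , λ a≢b at∈ bt∈ → inj₂ (refl , row at∈ bt∈ a≢b)
  ... | here refl with D , D↭ , good ← standardTiling (swap P) q p (trans (ℕ.+-comm (∣ c ∣ + ∣ d ∣) (∣ a ∣ + ∣ b ∣)) total) =
    D , ↭-trans D↭ (productWith-flip _⊗_ A C) , λ X X∈ → let sym-X , _ , column = good X X∈ in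
      sym-X , λ a≢b at∈ bt∈ → inj₂ (refl , column at∈ bt∈ a≢b)
  narrowTiling _ (_ ∷ (_ ∷ [-])) _ (s≤s (s≤s ())) _
  narrowTiling _ (_ ∷ (_ ∷ (_ ∷ _))) _ (s≤s (s≤s ())) _

  -- Both ends of the row project into `A`, which then runs from `⊥` to `⊤`. The length, after
  -- transposition, excludes full columns over a short `C`.
  full-row : ∀ {A a b C D X t} → Path a A b → concat D ↭ A ⊠ C → X ∈ˡ D →
    ⊥ ⊗ t ∈ˡ X → ⊤ ⊗ t ∈ˡ X → a ≡ ⊥ × b ≡ ⊤ × length A ≡ suc m
  full-row {A} {C = C} p D↭ X∈ ⊥t∈ ⊤t∈ =
    let ⊥∈ , _ = tile-⊠ P A C D↭ X∈ ⊥t∈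
        ⊤∈ , _ = tile-⊠ P A C D↭ X∈ ⊤t∈
        a≡⊥ , b≡⊤ = full-ends p ⊥∈ ⊤∈
    in a≡⊥ , b≡⊤ , full-length p ⊥∈ ⊤∈

-- Full rows and columns are the only source of conflicts between tiles of different members, so
-- they are confined to marked places.
MarkedTile : Product m n N → Chain m → Chain n → Subset m → Subset n → Chain N → Set
MarkedTile {N = N} P A C σ τ X = SymPath N X ×
  (∀ {t} → ⊥ ⊗ t ∈ˡ X → ⊤ ⊗ t ∈ˡ X → Marked τ C t) ×
  (∀ {s} → s ⊗ ⊥ ∈ˡ X → s ⊗ ⊤ ∈ˡ X → Marked σ A s)
  where open Product P

module _ {m n N : ℕ} (P : Product m n N) where
  open Product P

  full-column : ∀ {A C c d D X s} → Path c C d → concat D ↭ A ⊠ C → X ∈ˡ D →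
    s ⊗ ⊥ ∈ˡ X → s ⊗ ⊤ ∈ˡ X → c ≡ ⊥ × d ≡ ⊤ × length C ≡ suc n
  full-column {A} {C} q D↭ = full-row (swap P) {C = A} q (↭-trans D↭ (productWith-flip (flip _⊗_) C A))

module _ {m n N : ℕ} (P : Product m n N) (2≤m : 2 ≤ m) (2≤n : 2 ≤ n) where
  open Product P

  narrowMarkedTiling : ∀ {A C} σ {τ} → SymPath m A → SymPath n C → length C ≤ 2 →
    (length C ≡ 2 → τ ∈ˡ C) → Tiling _⊗_ A C (MarkedTile P A C σ τ)
  narrowMarkedTiling {A} {C} σ {τ} (a , b , p , a+b≡m) (c , d , q , c+d≡n) |C|≤2 τ∈C
    with D , D↭ , good ← narrowTiling P p q (trans (cong₂ _+_ a+b≡m c+d≡n) sum) |C|≤2 τ∈C =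
    D , D↭ , λ X X∈ → let sym-X , row = good X X∈ in sym-X , row-marked D↭ X∈ row , not-column D↭ X∈
    where
    row-marked : ∀ {D X} → concat D ↭ A ⊠ C → X ∈ˡ D →
      (∀ {t} → a ≢ b → a ⊗ t ∈ˡ X → b ⊗ t ∈ˡ X → Marked τ C t) →
      ∀ {t} → ⊥ ⊗ t ∈ˡ X → ⊤ ⊗ t ∈ˡ X → Marked τ C t
    row-marked D↭ X∈ row ⊥t∈ ⊤t∈ with refl , refl , _ ← full-row P {C = C} p D↭ X∈ ⊥t∈ ⊤t∈ =
      row (⊥≢⊤ (ℕ.<⇒≤ 2≤m)) ⊥t∈ ⊤t∈

    not-column : ∀ {D X s} → concat D ↭ A ⊠ C → X ∈ˡ D → s ⊗ ⊥ ∈ˡ X → s ⊗ ⊤ ∈ˡ X → Marked σ A s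
    -- A full column needs `suc n` elements in `C`, hence at least three.
    not-column D↭ X∈ s⊥∈ s⊤∈ =
      let _ , _ , |C|≡ = full-column P {A} q D↭ X∈ s⊥∈ s⊤∈
      in contradiction (ℕ.≤-trans (s≤s 2≤n) (subst (_≤ 2) |C|≡ |C|≤2)) λ where (s≤s (s≤s ()))

module _ {m n N : ℕ} (P : Product m n N) (2≤m : 2 ≤ m) (2≤n : 2 ≤ n) where
  open Product P

  -- A factor with at most two elements decides the tiling, after a transposition if only `A` is
  -- that short. Two longer factors admit a tiling that spans no row and no column.
  markedTiling : ∀ {A C σ τ} → SymPath m A → SymPath n C →
    (length A ≡ 2 → σ ∈ˡ A) → (length C ≡ 2 → τ ∈ˡ C) → Tiling _⊗_ A C (MarkedTile P A C σ τ)
  markedTiling {A} {C} {σ} {τ} symA@(a , b , p , a+b≡m) symC@(c , d , q , c+d≡n) σ∈A τ∈C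
    with length C ℕ.≤? 2 | length A ℕ.≤? 2
  ... | yes |C|≤2 | _ = narrowMarkedTiling P 2≤m 2≤n σ symA symC |C|≤2 τ∈C
  ... | no _ | yes |A|≤2
    with D , D↭ , good ← narrowMarkedTiling (swap P) 2≤n 2≤m τ symC symA |A|≤2 σ∈A =
    D , ↭-trans D↭ (productWith-flip _⊗_ A C) , λ X X∈ → let sym-X , column , row = good X X∈ in sym-X , row , column
  ... | no |C|>2 | no |A|>2
    with D , D↭ , good ← spanFreeTiling P p q (trans (cong₂ _+_ a+b≡m c+d≡n) sum) (ℕ.≰⇒> |A|>2) (ℕ.≰⇒> |C|>2) =
    D , D↭ , λ X X∈ → let sym-X , no-row , no-column = good X X∈ in sym-X ,
      (λ ⊥t∈ ⊤t∈ → let a≡⊥ , b≡⊤ , _ = full-row P {C = C} p D↭ X∈ ⊥t∈ ⊤t∈ in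
        contradiction (subst (λ b → b ⊗ _ ∈ˡ X) (sym b≡⊤) ⊤t∈) (no-row (subst (λ a → a ⊗ _ ∈ˡ X) (sym a≡⊥) ⊥t∈))) ,
      (λ s⊥∈ s⊤∈ → let c≡⊥ , d≡⊤ , _ = full-column P {A} q D↭ X∈ s⊥∈ s⊤∈ in
        contradiction (subst (λ d → _ ⊗ d ∈ˡ X) (sym d≡⊤) s⊤∈) (no-column (subst (λ c → _ ⊗ c ∈ˡ X) (sym c≡⊥) s⊥∈)))

-- Good collections yield product decompositions

-- The form of goodness common to both parities. `tail` takes the membership proof because the odd
-- condition attaches tails to positions.
record Marking (n k : ℕ) (F : Fin k → Family n) : Set where
  field
    tail     : ∀ i C → C ∈ˡ F i → Subset n
    tail∈    : ∀ i C (C∈ : C ∈ˡ F i) → length C ≡ 2 → tail i C C∈ ∈ˡ C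
    exclusive : ∀ i j → i ≢ j → ∀ {C D t} (C∈ : C ∈ˡ F i) (D∈ : D ∈ˡ F j) →
      Marked (tail i C C∈) C t → ¬ Marked (tail j D D∈) D t

even-sum : ∀ a → (a + a) % 2 ≡ 0
even-sum a = trans (cong (_% 2) (lemma a)) ([m+kn]%n≡m%n 0 a 2)
  where
  lemma : ∀ a → a + a ≡ 0 + a * 2
  lemma = solve-∀

odd-sum : ∀ a → (a + suc a) % 2 ≡ 1
odd-sum a = trans (cong (_% 2) (lemma a)) ([m+kn]%n≡m%n 1 a 2)
  where
  lemma : ∀ a → a + suc a ≡ 1 + a * 2
  lemma = solve-∀

singleton-parity : ∀ {C} → SymPath n C → length C ≡ 1 → n % 2 ≡ 0
singleton-parity (a , _ , [-] , eq) _ = trans (cong (_% 2) (sym eq)) (even-sum (∣ a ∣))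
singleton-parity (_ , _ , _ ∷ [-] , _) ()
singleton-parity (_ , _ , _ ∷ (_ ∷ _) , _) ()

pair-parity : ∀ {C} → SymPath n C → length C ≡ 2 → n % 2 ≡ 1
pair-parity (a , b , r ∷ [-] , eq) _ =
  trans (cong (_% 2) (trans (sym eq) (cong (∣ a ∣ +_) (proj₂ r)))) (odd-sum (∣ a ∣))
pair-parity (_ , _ , [-] , _) ()
pair-parity (_ , _ , _ ∷ (_ ∷ [-]) , _) ()
pair-parity (_ , _ , _ ∷ (_ ∷ (_ ∷ _)) , _) ()

-- The length of a symmetric chain has the parity of `suc n`, so marks come only from one-element
-- chains when `n` is even and only from tails when `n` is odd.
Good⇒Marking : ∀ {F} → (∀ i C → C ∈ˡ F i → SymPath n C) → Good n k F → Marking n k F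
Good⇒Marking {n} {F = F} symF (inj₁ (even , distinct)) = record
  -- A default value: for even `n` no chain has two elements.
  { tail = λ _ _ _ → ⊥
  ; tail∈ = λ i C C∈ |C|≡2 → contradiction |C|≡2 (no-pair C∈)
  ; exclusive = λ where
      i j i≢j C∈ D∈ (inj₁ refl) (inj₁ refl) → distinct i j i≢j _ _ C∈ D∈ refl refl refl
      i j _ C∈ _ (inj₂ (|C|≡2 , _)) _ → no-pair C∈ |C|≡2
      i j _ _ D∈ _ (inj₂ (|D|≡2 , _)) → no-pair D∈ |D|≡2
  }
  where
  no-pair : ∀ {i C} → C ∈ˡ F i → length C ≢ 2
  no-pair C∈ |C|≡2 = contradiction (trans (sym even) (pair-parity (symF _ _ C∈) |C|≡2)) λ ()
Good⇒Marking {n} {F = F} symF (inj₂ (odd , tail , tail∈ , tail-injective)) = record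
  { tail = λ i C C∈ → tail i (Any.index C∈)
  ; tail∈ = λ i C C∈ |C|≡2 → subst (tail i (Any.index C∈) ∈ˡ_) (sym (lookup-index C∈))
      (tail∈ i (Any.index C∈) (trans (cong length (sym (lookup-index C∈))) |C|≡2))
  ; exclusive = λ where
      i j _ C∈ _ (inj₁ refl) _ → no-singleton C∈ refl
      i j _ _ D∈ _ (inj₁ refl) → no-singleton D∈ refl
      i j i≢j C∈ D∈ (inj₂ (|C|≡2 , t≡)) (inj₂ (|D|≡2 , t≡′)) → i≢j (proj₁ (tail-injective i _ j _
        (trans (cong length (sym (lookup-index C∈))) |C|≡2)
        (trans (cong length (sym (lookup-index D∈))) |D|≡2) (trans (sym t≡) t≡′)))
  }
  where
  no-singleton : ∀ {i C} → C ∈ˡ F i → length C ≢ 1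
  no-singleton C∈ |C|≡1 = contradiction (trans (sym odd) (singleton-parity (symF _ _ C∈) |C|≡1)) λ ()

InProductRectangles : Product m n N → Family N → Family m → Family n → Set
InProductRectangles P H F G = ∀ X → X ∈ˡ H → ∃[ A ] ∃[ C ] (A ∈ˡ F × C ∈ˡ G ×
  (∀ x → x ∈ˡ X → ∃[ S ] ∃[ T ] (S ∈ˡ A × T ∈ˡ C × x ≡ S ⊗ T)))
  where open Product P

module Sufficiency (P : Product m n N) (2≤m : 2 ≤ m) (2≤n : 2 ≤ n)
  {F : Fin k → Family m} {G : Fin k → Family n}
  (scdF : ∀ i → IsSCD m (F i)) (scdG : ∀ i → IsSCD n (G i))
  (meetsF : ∀ i j → i ≢ j → MeetsOnlyAtEnds m (F i) (F j))
  (meetsG : ∀ i j → i ≢ j → MeetsOnlyAtEnds n (G i) (G j))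
  (split : ∀ x → ∃[ S ] ∃[ T ] (x ≡ Product._⊗_ P S T))
  (markF : Marking m k F) (markG : Marking n k G)
  where

  open Product P
  module MF = Marking markF
  module MG = Marking markG

  InTile : Fin k → Chain N → Set
  InTile i X = Σ (Chain m) λ A → Σ (Chain n) λ C → Σ (A ∈ˡ F i) λ A∈ → Σ (C ∈ˡ G i) λ C∈ →
    (∀ x → x ∈ˡ X → ∃[ S ] ∃[ T ] (S ∈ˡ A × T ∈ˡ C × x ≡ S ⊗ T)) ×
    MarkedTile P A C (MF.tail i A A∈) (MG.tail i C C∈) X

  tiles : ∀ i → Tiling _⊗_ (concat (F i)) (concat (G i)) (InTile i)
  tiles i = tiling-concatˡ (F i) (concat (G i)) λ A A∈ → tiling-concatʳ A (G i) λ C C∈ →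
    let D , D↭ , good = markedTiling P 2≤m 2≤n
          (SymChain⇒SymPath (proj₁ (scdF i) A A∈)) (SymChain⇒SymPath (proj₁ (scdG i) C C∈))
          (MF.tail∈ i A A∈) (MG.tail∈ i C C∈)
    in D , D↭ , λ X X∈ → A , C , A∈ , C∈ ,
         (λ x x∈ → ∈-cartesianProductWith⁻ _⊗_ A C (∈-resp-↭ D↭ (∈-concat⁺′ x∈ X∈))) , good X X∈

  H : Fin k → Family N
  H i = proj₁ (tiles i)

  H↭ : ∀ i → concat (H i) ↭ concat (F i) ⊠ concat (G i)
  H↭ i = proj₁ (proj₂ (tiles i))

  inTile : ∀ i X → X ∈ˡ H i → InTile i X
  inTile i = proj₂ (proj₂ (tiles i))

  symH : ∀ i X → X ∈ˡ H i → SymPath N X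
  symH i X X∈ = let _ , _ , _ , _ , _ , sym-X , _ = inTile i X X∈ in sym-X

  scdH : ∀ i → IsSCD N (H i)
  scdH i = (λ X X∈ → SymPath⇒SymChain (symH i X X∈)) , covered ,
    Unique-resp-↭ (setoid _) (↭⇒↭ₛ (↭-sym (H↭ i)))
      (Unique.cartesianProductWith⁺ _⊗_ injective (proj₂ (proj₂ (scdF i))) (proj₂ (proj₂ (scdG i))))
    where
    covered : ∀ x → x ∈ˡ concat (H i)
    covered x with S , T , refl ← split x = ∈-resp-↭ (↭-sym (H↭ i))
      (∈-cartesianProductWith⁺ _⊗_ (proj₁ (proj₂ (scdF i)) S) (proj₁ (proj₂ (scdG i)) T))

  ⊥⊗⊥ : ⊥ ⊗ ⊥ ≡ ⊥
  ⊥⊗⊥ = ∣p∣≡0⇒p≡⊥ (trans (size (⊥ {m}) (⊥ {n})) (cong₂ _+_ (∣⊥∣≡0 m) (∣⊥∣≡0 n)))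

  ⊤⊗⊤ : ⊤ ⊗ ⊤ ≡ ⊤
  ⊤⊗⊤ = ∣p∣≡n⇒p≡⊤ (trans (size (⊤ {m}) (⊤ {n})) (trans (cong₂ _+_ (∣⊤∣≡n m) (∣⊤∣≡n n)) sum))

  -- Both coordinates grow weakly from `x` to `y`. If both grow strictly, the conditions on `F` and
  -- `G` make `x` and `y` the two ends. If only one does, `X` and `Y` share a full row or column,
  -- which the markings forbid.
  meetsH : ∀ i j → i ≢ j → MeetsOnlyAtEnds N (H i) (H j)
  meetsH i j i≢j {X} {Y} X∈ Y∈ x∈X x∈Y y∈X y∈Y x<y
    with A , C , A∈ , C∈ , X⊆ , (_ , _ , path-X , _) , rowX , columnX ← inTile i X X∈
       | B , D , B∈ , D∈ , Y⊆ , _ , rowY , columnY ← inTile j Y Y∈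
    with S , T , S∈A , T∈C , refl ← X⊆ _ x∈X | S′ , T′ , S′∈A , T′∈C , refl ← X⊆ _ y∈X
    with _ , _ , S∈B , T∈D , eq ← Y⊆ _ x∈Y | _ , _ , S′∈B , T′∈D , eq′ ← Y⊆ _ y∈Y
    with refl , refl ← injective eq | refl , refl ← injective eq′
    with S⊆S′ , T⊆T′ ← reflect {S} {S′} (Path-⊆ path-X x∈X y∈X (ℕ.<⇒≤ x<y))
    with ℕ.m≤n⇒m<n∨m≡n (p⊆q⇒∣p∣≤∣q∣ S⊆S′) | ℕ.m≤n⇒m<n∨m≡n (p⊆q⇒∣p∣≤∣q∣ T⊆T′)
  ... | inj₁ S<S′ | inj₁ T<T′
    with refl , refl ← meetsF i j i≢j A∈ B∈ S∈A S∈B S′∈A S′∈B S<S′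
       | refl , refl ← meetsG i j i≢j C∈ D∈ T∈C T∈D T′∈C T′∈D T<T′ = ⊥⊗⊥ , ⊤⊗⊤
  ... | inj₂ |S|≡ | inj₂ |T|≡ =
    contradiction (trans (size S T) (trans (cong₂ _+_ |S|≡ |T|≡) (sym (size S′ T′)))) (ℕ.<⇒≢ x<y)
  ... | inj₁ S<S′ | inj₂ |T|≡
    with refl , refl ← meetsF i j i≢j A∈ B∈ S∈A S∈B S′∈A S′∈B S<S′
       | _ , _ , path-C , _ ← SymChain⇒SymPath (proj₁ (scdG i) C C∈)
    with refl ← Path-size-injective path-C T∈C T′∈C |T|≡ =
    contradiction (rowY x∈Y y∈Y) (MG.exclusive i j i≢j C∈ D∈ (rowX x∈X y∈X))
  ... | inj₂ |S|≡ | inj₁ T<T′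
    with refl , refl ← meetsG i j i≢j C∈ D∈ T∈C T∈D T′∈C T′∈D T<T′
       | _ , _ , path-A , _ ← SymChain⇒SymPath (proj₁ (scdF i) A A∈)
    with refl ← Path-size-injective path-A S∈A S′∈A |S|≡ =
    contradiction (columnY x∈Y y∈Y) (MF.exclusive i j i≢j A∈ B∈ (columnX x∈X y∈X))

  inRectangles : ∀ i → InProductRectangles P (H i) (F i) (G i)
  inRectangles i X X∈ = let A , C , A∈ , C∈ , X⊆ , _ = inTile i X X∈ in A , C , A∈ , C∈ , X⊆

-- Product decompositions force goodness

Unique-++-disjoint : ∀ {X : Set} {A B : List X} {x} → Unique (A ++ B) → x ∈ˡ A → ¬ (x ∈ˡ B)
Unique-++-disjoint {A = _ ∷ A} (x∉ ∷ _) (here refl) x∈B = All.lookup x∉ (∈-++⁺ʳ A x∈B) refl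
Unique-++-disjoint (_ ∷ u) (there x∈A) x∈B = Unique-++-disjoint u x∈A x∈B

Unique-++ʳ : ∀ {X : Set} (A : List X) {B} → Unique (A ++ B) → Unique B
Unique-++ʳ []      u       = u
Unique-++ʳ (_ ∷ A) (_ ∷ u) = Unique-++ʳ A u

-- Chains are compared by position, as the odd condition requires.
Unique-concat-index : ∀ {X : Set} (F : List (List X)) → Unique (concat F) → ∀ a b {x} →
  x ∈ˡ lookup F a → x ∈ˡ lookup F b → a ≡ b
Unique-concat-index (A ∷ F) u Fin.zero    Fin.zero    _   _   = refl
Unique-concat-index (A ∷ F) u Fin.zero    (Fin.suc b) x∈a x∈b =
  contradiction (∈-concat⁺′ x∈b (∈-lookup {xs = F} b)) (Unique-++-disjoint u x∈a)
Unique-concat-index (A ∷ F) u (Fin.suc a) Fin.zero    x∈a x∈b =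
  contradiction (∈-concat⁺′ x∈a (∈-lookup {xs = F} a)) (Unique-++-disjoint u x∈b)
Unique-concat-index (A ∷ F) u (Fin.suc a) (Fin.suc b) x∈a x∈b =
  cong Fin.suc (Unique-concat-index F (Unique-++ʳ A u) a b x∈a x∈b)

Unique-concat-member : ∀ {X : Set} {F : List (List X)} {A B x} → Unique (concat F) → A ∈ˡ F → B ∈ˡ F →
  x ∈ˡ A → x ∈ˡ B → A ≡ B
Unique-concat-member {F = F} u A∈ B∈ x∈A x∈B =
  trans (lookup-index A∈) (trans (cong (lookup F) eq) (sym (lookup-index B∈)))
  where
  eq = Unique-concat-index F u (Any.index A∈) (Any.index B∈)
    (subst (_ ∈ˡ_) (lookup-index A∈) x∈A) (subst (_ ∈ˡ_) (lookup-index B∈) x∈B)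

module Necessity (P : Product m n N) (1≤m : 1 ≤ m) (1≤n : 1 ≤ n) where
  open Product P

  FullRow : Family N → Subset n → Set
  FullRow H t = ∃[ X ] (X ∈ˡ H × ⊥ ⊗ t ∈ˡ X × ⊤ ⊗ t ∈ˡ X)

  size-⊥⊗ : ∀ t → ∣ ⊥ ⊗ t ∣ ≡ ∣ t ∣
  size-⊥⊗ t = trans (size ⊥ t) (cong (_+ ∣ t ∣) (∣⊥∣≡0 m))

  size-⊤⊗ : ∀ t → ∣ ⊤ ⊗ t ∣ ≡ m + ∣ t ∣
  size-⊤⊗ t = trans (size ⊤ t) (cong (_+ ∣ t ∣) (∣⊤∣≡n m))

  -- Otherwise `⊥ ⊗ t` and `⊤ ⊗ t` would be bottom and top of the product, and `t` would have size 0
  -- and size `n` at once.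
  FullRow-exclusive : ∀ {H H′ t} → MeetsOnlyAtEnds N H H′ → FullRow H t → ¬ FullRow H′ t
  FullRow-exclusive {t = t} meets (X , X∈ , ⊥t∈X , ⊤t∈X) (Y , Y∈ , ⊥t∈Y , ⊤t∈Y) =
    ℕ.<⇒≢ 1≤n (trans (sym |t|≡0) |t|≡n)
    where
    both-ends = meets X∈ Y∈ ⊥t∈X ⊥t∈Y ⊤t∈X ⊤t∈Y
      (subst₂ _<_ (sym (size-⊥⊗ t)) (sym (size-⊤⊗ t)) (ℕ.+-monoˡ-≤ ∣ t ∣ 1≤m))
    |t|≡0 : ∣ t ∣ ≡ 0
    |t|≡0 = trans (sym (size-⊥⊗ t)) (trans (cong ∣_∣ (proj₁ both-ends)) (∣⊥∣≡0 N))
    |t|≡n : ∣ t ∣ ≡ n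
    |t|≡n = ℕ.+-cancelˡ-≡ m _ _
      (trans (sym (size-⊤⊗ t)) (trans (cong ∣_∣ (proj₂ both-ends)) (trans (∣⊤∣≡n N) (sym sum))))

  module _ {F : Family m} {G : Family n} {H : Family N}
    (scdF : IsSCD m F) (scdG : IsSCD n G) (scdH : IsSCD N H) (inRect : InProductRectangles P H F G) where

    symH : ∀ {X} → X ∈ˡ H → SymPath N X
    symH X∈ = SymChain⇒SymPath (proj₁ scdH _ X∈)

    -- The chain through `⊥` also contains an element of the mirrored size `m`.
    fullChain : ∃[ A ] (A ∈ˡ F × ⊥ ∈ˡ A × ⊤ ∈ˡ A)
    fullChain =
      let A , ⊥∈ , A∈ = ∈-concat⁻′ F (proj₁ (proj₂ scdF) ⊥)
          y , y∈ , eq = SymPath-mirror (SymChain⇒SymPath (proj₁ scdF A A∈)) ⊥∈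
      in A , A∈ , ⊥∈ , subst (_∈ˡ A) (∣p∣≡n⇒p≡⊤ (trans (cong (_+ ∣ y ∣) (sym (∣⊥∣≡0 m))) eq)) y∈

    -- Distinct chains of `F` are disjoint, and so are those of `G`; hence the rectangle around the
    -- chain of `H` through `S ⊗ T` must be that of `A` and `C`.
    chain-through : ∀ {A C} → A ∈ˡ F → C ∈ˡ G → ∀ {S T} → S ∈ˡ A → T ∈ˡ C →
      ∃[ X ] (X ∈ˡ H × S ⊗ T ∈ˡ X × (∀ x → x ∈ˡ X → ∃[ S ] ∃[ T ] (S ∈ˡ A × T ∈ˡ C × x ≡ S ⊗ T)))
    chain-through A∈ C∈ {S} {T} S∈ T∈
      with X , ST∈ , X∈ ← ∈-concat⁻′ H (proj₁ (proj₂ scdH) (S ⊗ T))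
      with A′ , C′ , A′∈ , C′∈ , X⊆ ← inRect X X∈
      with _ , _ , S∈′ , T∈′ , eq ← X⊆ (S ⊗ T) ST∈
      with refl , refl ← injective eq
      with refl ← Unique-concat-member (proj₂ (proj₂ scdF)) A∈ A′∈ S∈ S∈′
         | refl ← Unique-concat-member (proj₂ (proj₂ scdG)) C∈ C′∈ T∈ T∈′ = X , X∈ , ST∈ , X⊆

    -- The mirror image of `⊥ ⊗ x` in its chain still has right coordinate `x`. Since `x` has half
    -- the size `n`, the left coordinate must have size `m`.
    fullRow-singleton : ∀ {x} → [ x ] ∈ˡ G → FullRow H x
    fullRow-singleton {x} C∈
      with A , A∈ , ⊥∈ , ⊤∈ ← fullChain
      with _ , _ , [-] , x+x≡n ← SymChain⇒SymPath (proj₁ scdG _ C∈)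
      with X , X∈ , ⊥x∈ , X⊆ ← chain-through A∈ C∈ ⊥∈ (here refl)
      with _ , w∈ , ⊥x+w≡N ← SymPath-mirror (symH X∈) ⊥x∈
      with S , _ , _ , here refl , refl ← X⊆ _ w∈
      = X , X∈ , ⊥x∈ , subst (λ S → S ⊗ x ∈ˡ X) (∣p∣≡n⇒p≡⊤ |S|≡m) w∈
      where
      open ≡-Reasoning
      |S|≡m : ∣ S ∣ ≡ m
      |S|≡m = ℕ.+-cancelʳ-≡ (∣ x ∣ + ∣ x ∣) _ _ (begin
        ∣ S ∣ + (∣ x ∣ + ∣ x ∣)   ≡⟨ lemma (∣ S ∣) (∣ x ∣) ⟩
        ∣ x ∣ + (∣ S ∣ + ∣ x ∣)   ≡⟨ cong₂ _+_ (size-⊥⊗ x) (size S x) ⟨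
        ∣ ⊥ ⊗ x ∣ + ∣ S ⊗ x ∣     ≡⟨ ⊥x+w≡N ⟩
        N                         ≡⟨ sum ⟨
        m + n                     ≡⟨ cong (m +_) x+x≡n ⟨
        m + (∣ x ∣ + ∣ x ∣)       ∎)
        where
        lemma : ∀ s x → s + (x + x) ≡ x + (s + x)
        lemma = solve-∀

    private
      N≡ : ∀ x y → x + y ≡ n → N ≡ m + (x + y)
      N≡ _ _ x+y≡n = trans (sym sum) (cong (m +_) (sym x+y≡n))

      swap-sum : ∀ a b c → a + (b + c) ≡ b + (a + c)
      swap-sum = solve-∀

      +-cancelˡ : ∀ a {b c} → a + b ≡ a + c → b ≡ c
      +-cancelˡ a = ℕ.+-cancelˡ-≡ a _ _

      +-cancelʳ : ∀ a {b c} → b + a ≡ c + a → b ≡ c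
      +-cancelʳ a = ℕ.+-cancelʳ-≡ a _ _

    -- The chain X through (⊥,x) reaches (⊤,y).  At size |x| + 1 it contains either (⊥,y),
    -- and so the full row y, or (S,x) with |S| = 1.  In the latter case the chain Z through
    -- (⊤,x) cannot contain (⊥,y), so it also contains (S,x); hence X = Z has the full row x.
    fullRow-pair : ∀ {x y} → (x ∷ y ∷ []) ∈ˡ G → ∃[ t ] (t ∈ˡ x ∷ y ∷ [] × FullRow H t)
    fullRow-pair {x} {y} C∈
      with A , A∈ , ⊥∈ , ⊤∈ ← fullChain
      with _ , _ , (_ , |y|≡) ∷ [-] , x+y≡n ← SymChain⇒SymPath (proj₁ scdG _ C∈)
         | _ , _ , path-A , _ ← SymChain⇒SymPath (proj₁ scdF A A∈)
      with X , X∈ , ⊥x∈X , X⊆ ← chain-through A∈ C∈ ⊥∈ (here refl)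
         | Z , Z∈ , ⊤x∈Z , Z⊆ ← chain-through A∈ C∈ ⊤∈ (here refl)
      with w , w∈ , ⊥x+w≡N ← SymPath-mirror (symH X∈) ⊥x∈X
         | z , z∈ , ⊤x+z≡N ← SymPath-mirror (symH Z∈) ⊤x∈Z
         | _ , _ , path-X , _ ← symH X∈
         | _ , _ , path-Z , _ ← symH Z∈
      -- By symmetry `w` has size `m + ∣ y ∣`, and `z` has size `∣ y ∣`, the same as the size
      -- `suc ∣ x ∣` at which `e` is taken.
      with |w|≡ ← +-cancelˡ (∣ x ∣) (trans (cong (_+ ∣ w ∣) (sym (size-⊥⊗ x)))
             (trans ⊥x+w≡N (trans (N≡ (∣ x ∣) (∣ y ∣) x+y≡n) (swap-sum m (∣ x ∣) (∣ y ∣)))))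
         | |z|≡ ← +-cancelˡ (m + ∣ x ∣) (trans (cong (_+ ∣ z ∣) (sym (size-⊤⊗ x)))
             (trans ⊤x+z≡N (trans (N≡ (∣ x ∣) (∣ y ∣) x+y≡n) (sym (ℕ.+-assoc m (∣ x ∣) (∣ y ∣))))))
      with e , e∈ , |e|≡ ← Path-size-surjective {r = suc ∣ x ∣} path-X
             (≤-trans (Path-start-≤ path-X ⊥x∈X) (subst (_≤ suc ∣ x ∣) (sym (size-⊥⊗ x)) (ℕ.n≤1+n ∣ x ∣)))
             (≤-trans (subst₂ _≤_ |y|≡ (sym |w|≡) (ℕ.m≤n+m ∣ y ∣ m)) (Path-end-≤ path-X w∈))
      with X⊆ e e∈ | X⊆ w w∈ | Z⊆ z z∈
    ... | S , _ , _ , there (here refl) , refl | S′ , _ , _ , there (here refl) , refl | _ =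
      y , there (here refl) , X , X∈ ,
        subst (λ S → S ⊗ y ∈ˡ X) (∣p∣≡0⇒p≡⊥ (+-cancelʳ (∣ y ∣) (trans (sym (size S y)) (trans |e|≡ (sym |y|≡))))) e∈ ,
        subst (λ S → S ⊗ y ∈ˡ X) (∣p∣≡n⇒p≡⊤ (+-cancelʳ (∣ y ∣) (trans (sym (size S′ y)) |w|≡))) w∈
    -- With right coordinate `x`, the size of `w` would require a left coordinate of size `suc m`.
    ... | _ | S′ , _ , _ , here refl , refl | _ =
      contradiction (∣p∣≤n S′) (ℕ.<⇒≱ (ℕ.≤-reflexive (sym (+-cancelʳ (∣ x ∣)
        (trans (sym (size S′ x)) (trans |w|≡ (trans (cong (m +_) |y|≡) (+-suc m ∣ x ∣))))))))
    ... | S , _ , S∈ , here refl , refl | _ | S″ , _ , S″∈ , here refl , refl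
      with refl ← Path-size-injective path-A S∈ S″∈ (+-cancelʳ (∣ x ∣)
             (trans (sym (size S x)) (trans |e|≡ (trans (sym |y|≡) (trans (sym |z|≡) (size S″ x))))))
      with refl ← Unique-concat-member (proj₂ (proj₂ scdH)) X∈ Z∈ e∈ z∈
      = x , here refl , X , X∈ , ⊥x∈X , ⊤x∈Z
    -- By size, `S″ ⊗ y` would lie below `⊤ ⊗ x` in `Z`, forcing `y ⊆ x`.
    ... | _ | _ | S″ , _ , _ , there (here refl) , refl =
      contradiction (p⊆q⇒∣p∣≤∣q∣ (proj₂ (reflect (Path-⊆ path-Z z∈ ⊤x∈Z z≤⊤x))))
        (ℕ.<⇒≱ (ℕ.≤-reflexive (sym |y|≡)))
      where
      z≤⊤x : ∣ S″ ⊗ y ∣ ≤ ∣ ⊤ ⊗ x ∣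
      z≤⊤x = subst₂ _≤_ (sym (trans |z|≡ |y|≡)) (sym (size-⊤⊗ x)) (ℕ.+-monoˡ-≤ ∣ x ∣ 1≤m)

    fullRow : ∀ {C} → C ∈ˡ G → length C ≡ 2 → ∃[ t ] (t ∈ˡ C × FullRow H t)
    fullRow {_ ∷ _ ∷ []} C∈ _ = fullRow-pair C∈

  -- The rows forced by the shortest chains of `G` are exclusive to their members. For odd `n`, the
  -- place of the forced row serves as the tail.
  FullRows⇒Good : ∀ {k} {F : Fin k → Family m} {G : Fin k → Family n} {H : Fin k → Family N} →
    (∀ i → IsSCD m (F i)) → (∀ i → IsSCD n (G i)) → (∀ i → IsSCD N (H i)) →
    (∀ i j → i ≢ j → MeetsOnlyAtEnds N (H i) (H j)) →
    (∀ i → InProductRectangles P (H i) (F i) (G i)) → Good n k G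
  FullRows⇒Good {k} {G = G} {H} scdF scdG scdH meetsH inRect with n % 2 | m%n<n n 2
  ... | 0 | _ = inj₁ (refl , distinct)
    where
    distinct : EvenCond n k G
    distinct i j i≢j (t ∷ []) _ A∈ B∈ _ _ refl = FullRow-exclusive (meetsH i j i≢j)
      (fullRow-singleton (scdF i) (scdG i) (scdH i) (inRect i) A∈)
      (fullRow-singleton (scdF j) (scdG j) (scdH j) (inRect j) B∈)
  ... | 1 | _ = inj₂ (refl , (λ i a → proj₁ (tail i a)) , (λ i a |C|≡2 → proj₁ (proj₂ (tail i a) |C|≡2)) , tail-injective)
    where
    tail : ∀ i a → ∃[ t ] (length (lookup (G i) a) ≡ 2 → t ∈ˡ lookup (G i) a × FullRow (H i) t)
    tail i a with length (lookup (G i) a) ℕ.≟ 2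
    ... | yes |C|≡2 = let t , good = fullRow (scdF i) (scdG i) (scdH i) (inRect i) (∈-lookup a) |C|≡2 in t , λ _ → good
    -- A default value for chains that are not edges of the graph.
    ... | no |C|≢2 = ⊥ , λ |C|≡2 → contradiction |C|≡2 |C|≢2

    tail-injective : ∀ i a j b → length (lookup (G i) a) ≡ 2 → length (lookup (G j) b) ≡ 2 →
      proj₁ (tail i a) ≡ proj₁ (tail j b) → i ≡ j × toℕ a ≡ toℕ b
    tail-injective i a j b |C|≡2 |D|≡2 eq with tail i a | tail j b | eq
    ... | t , good | _ , good′ | refl with good |C|≡2 | good′ |D|≡2 | i Fin.≟ j
    -- Within one member the common tail lies in two chains of a partition, so their positions
    -- agree.
    ...   | t∈ , _ | t∈′ , _ | yes refl = refl , cong toℕ (Unique-concat-index (G i) (proj₂ (proj₂ (scdG i))) a b t∈ t∈′)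
    ...   | _ , full | _ , full′ | no i≢j = contradiction full′ (FullRow-exclusive (meetsH i j i≢j) full)
  ... | suc (suc _) | s≤s (s≤s ())

theorem5p6 : (m n k : ℕ) → 2 ≤ m → 2 ≤ n → 1 ≤ k →
    (F : Fin k → Family m) → (G : Fin k → Family n) →
    (∀ i → IsSCD m (F i)) → (∀ i → IsSCD n (G i)) →
    PairwiseAO m k F → PairwiseAO n k G →
    (Σ (Fin k → Family (m + n)) λ H →
    (∀ i → IsSCD (m + n) (H i)) × PairwiseAO (m + n) k H ×
    (∀ i → InRectangles m n (H i) (F i) (G i)))
    ⇔ (Good m k F × Good n k G)
theorem5p6 m n k 2≤m 2≤n _ F G scdF scdG aoF aoG = mk⇔ necessary sufficient
  where
  P = concatenation m n
  1≤m = ℕ.<⇒≤ 2≤m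
  1≤n = ℕ.<⇒≤ 2≤n
  1≤m+n = ≤-trans 1≤m (ℕ.m≤m+n m n)

  necessary : _ → _
  necessary (H , scdH , aoH , inRect) =
    -- Full rows concern the right factor; the transposed product handles `F`.
    Necessity.FullRows⇒Good (swap P) 1≤n 1≤m scdG scdF scdH meetsH inRectᵀ ,
    Necessity.FullRows⇒Good P 1≤m 1≤n scdF scdG scdH meetsH inRect
    where
    meetsH : ∀ i j → i ≢ j → MeetsOnlyAtEnds (m + n) (H i) (H j)
    meetsH i j i≢j = AlmostOrthogonal⇒MeetsOnlyAtEnds 1≤m+n (aoH i j i≢j)
    inRectᵀ : ∀ i → InProductRectangles (swap P) (H i) (G i) (F i)
    inRectᵀ i X X∈ = let A , C , A∈ , C∈ , X⊆ = inRect i X X∈ in C , A , C∈ , A∈ ,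
      λ x x∈ → let S , T , S∈ , T∈ , eq = X⊆ x x∈ in T , S , T∈ , S∈ , eq

  sufficient : _ → _
  sufficient (goodF , goodG) = S.H , S.scdH ,
    (λ i j i≢j → MeetsOnlyAtEnds⇒AlmostOrthogonal 1≤m+n (S.symH i) (S.meetsH i j i≢j)) , S.inRectangles
    where
    module S = Sufficiency P 2≤m 2≤n scdF scdG
      (λ i j i≢j → AlmostOrthogonal⇒MeetsOnlyAtEnds 1≤m (aoF i j i≢j))
      (λ i j i≢j → AlmostOrthogonal⇒MeetsOnlyAtEnds 1≤n (aoG i j i≢j))
      (λ x → Vec.splitAt m x)
      (Good⇒Marking (λ i C C∈ → SymChain⇒SymPath (proj₁ (scdF i) C C∈)) goodF)
      (Good⇒Marking (λ i C C∈ → SymChain⇒SymPath (proj₁ (scdG i) C C∈)) goodG)
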